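{- Let $a_2(n)$ denote the number of $2$-core partitions of $n$. For all $\alpha\ge1$, $\beta\ge0$, $n\ge0$ and $i\in\{1,2\}$, $$a_2\left(3^{2\alpha}n+3^{2\alpha-1}i+\frac{3^{2\alpha}-1}{8}\right)\equiv0\pmod2$$ and $$a_2\left(\frac{3^{2\beta}-1}{8}\right)\equiv1\pmod2.$$
   Context: A partition is a $t$-core partition if none of its hook lengths is divisible by $t$; $a_t(n)$ is the number of $t$-core partitions of $n$. Its generating function (Garvan–Kim–Stanton) is $\sum_{n\ge0}a_t(n)q^n=\prod_{n\ge1}\frac{(1-q^{tn})^t}{1-q^n}$. -}

module Defs where

open import Data.List using (List; []; _∷_; _++_; length; filter; map; concatMap; upTo)
open import Data.List.Membership.Propositional using (_∈_; find; lose)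
open import Data.List.Membership.Propositional.Properties
  using (∈-map⁺; ∈-map⁻; ∈-concatMap⁺; ∈-concatMap⁻; ∈-upTo⁺; ∈-upTo⁻)
open import Data.List.Properties using (∷-injectiveˡ; ∷-injectiveʳ)
open import Data.List.Relation.Binary.Disjoint.Propositional using (Disjoint)
open import Data.List.Relation.Unary.All as All using (All; []; _∷_)
import Data.List.Relation.Unary.All.Properties as All
import Data.List.Relation.Unary.AllPairs as AllPairs
import Data.List.Relation.Unary.AllPairs.Properties as AllPairs
open import Data.List.Relation.Unary.Any using (here; there)
open import Data.List.Relation.Unary.Linked as Linked using (Linked; []; [-]; _∷_)
open import Data.List.Relation.Unary.Unique.Propositional using (Unique; []; _∷_)
import Data.List.Relation.Unary.Unique.Propositional.Properties as Unique
open import Data.Nat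
open import Data.Nat.Divisibility using (_∤_; _∣?_)
open import Data.Nat.ListAction using (sum)
open import Data.Nat.Properties
open import Data.Product using (_×_; _,_)
open import Relation.Binary.PropositionalEquality using (_≡_; _≢_; refl; sym; trans; cong)
open import Relation.Nullary using (Dec)
open import Relation.Nullary.Decidable using (¬?)

record IsPartition (n : ℕ) (ps : List ℕ) : Set where
  constructor isPartition
  field
    weaklyDecreasing : Linked _≥_ ps
    positive         : All (0 <_) ps
    sum≡n            : sum ps ≡ n

-- The hook length of the cell in column j (counted from 0) of a first row of
-- length p above the rows ps: its arm is p ∸ suc j, its leg is the number of
-- rows below that are longer than j, and the cell itself counts once.
hookLength : ℕ → List ℕ → ℕ → ℕ
hookLength p ps j = (p ∸ suc j) + length (filter (j <?_) ps) + 1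

-- The hook lengths of all cells.  Arms and legs only look right and down, so
-- the hooks below the first row are those of the remaining rows.
hookLengths : List ℕ → List ℕ
hookLengths []       = []
hookLengths (p ∷ ps) = map (hookLength p ps) (upTo p) ++ hookLengths ps

IsCore : ℕ → List ℕ → Set
IsCore t ps = All (t ∤_) (hookLengths ps)

isCore? : ∀ t ps → Dec (IsCore t ps)
isCore? t ps = All.all? (λ h → ¬? (t ∣? h)) (hookLengths ps)

-- Partitions of n with at most f parts, all of them at most m; the part
-- chosen first is suc p, which leaves suc n ∸ suc p = n ∸ p.
boundedPartitions : (f m n : ℕ) → List (List ℕ)
boundedPartitions _       _ zero    = [] ∷ []
boundedPartitions zero    _ (suc _) = []
boundedPartitions (suc f) m (suc n) =
  concatMap (λ p → map (suc p ∷_) (boundedPartitions f (suc p) (n ∸ p))) (upTo (m ⊓ suc n))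

partitions : ℕ → List (List ℕ)
partitions n = boundedPartitions n n n

-- The number of t-core partitions of n.
a : ℕ → ℕ → ℕ
a t n = length (filter (isCore? t) (partitions n))

-- The rest shows that  partitions n  lists the partitions of n, each exactly
-- once, so that  a t n  is indeed a cardinality.

private

  sound : ∀ f m n {ps} → ps ∈ boundedPartitions f m n →
          Linked _≥_ (m ∷ ps) × All (0 <_) ps × sum ps ≡ n
  sound zero    m zero (here refl) = [-] , [] , refl
  sound (suc f) m zero (here refl) = [-] , [] , refl
  sound (suc f) m (suc n) ps∈
    with p , p∈ , ps∈′ ← find (∈-concatMap⁻ _ {xs = upTo (m ⊓ suc n)} ps∈)
    with qs , qs∈ , refl ← ∈-map⁻ (suc p ∷_) ps∈′
    with linked , pos , sum≡ ← sound f (suc p) (n ∸ p) qs∈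
    with p< ← ∈-upTo⁻ p∈
    = ≤-trans p< (m⊓n≤m m (suc n)) ∷ linked
    , z<s ∷ pos
    , cong suc (trans (cong (p +_) sum≡) (m+[n∸m]≡n (s≤s⁻¹ (≤-trans p< (m⊓n≤n m (suc n))))))

  complete : ∀ f m {n} ps → Linked _≥_ (m ∷ ps) → All (0 <_) ps → sum ps ≡ n → n ≤ f →
             ps ∈ boundedPartitions f m n
  complete zero    m []       _ _ refl _ = here refl
  complete (suc f) m []       _ _ refl _ = here refl
  complete zero    m (zero ∷ _)  _ (() ∷ _)
  complete zero    m (suc _ ∷ _) _ _ refl ()
  complete (suc f) m (suc p ∷ ps) (p<m ∷ linked) (_ ∷ pos) refl (s≤s n≤f) =
    ∈-concatMap⁺ _ (lose (∈-upTo⁺ (⊓-glb p<m (s≤s (m≤m+n p (sum ps)))))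
      (∈-map⁺ (suc p ∷_) (complete f (suc p) ps linked pos (sym (m+n∸m≡n p (sum ps)))
        (≤-trans (m∸n≤m (p + sum ps) p) n≤f))))

  unique : ∀ f m n → Unique (boundedPartitions f m n)
  unique zero    m zero    = [] ∷ []
  unique (suc f) m zero    = [] ∷ []
  unique zero    m (suc n) = []
  unique (suc f) m (suc n) = Unique.concat⁺
    (All.map⁺ (All.universal (λ p → Unique.map⁺ ∷-injectiveʳ (unique f (suc p) (n ∸ p))) _))
    (AllPairs.map⁺ (AllPairs.map disjoint (Unique.upTo⁺ (m ⊓ suc n))))
    where
    disjoint : ∀ {p q} {xs ys : List (List ℕ)} → p ≢ q →
               Disjoint (map (suc p ∷_) xs) (map (suc q ∷_) ys)
    disjoint p≢q (u , v)
      with _ , _ , refl ← ∈-map⁻ _ u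
      with _ , _ , eq   ← ∈-map⁻ _ v
      = p≢q (suc-injective (∷-injectiveˡ eq))

∈-partitions⁻ : ∀ {n ps} → ps ∈ partitions n → IsPartition n ps
∈-partitions⁻ {n} ps∈ with linked , pos , sum≡ ← sound n n n ps∈ =
  isPartition (Linked.tail linked) pos sum≡

∈-partitions⁺ : ∀ {n ps} → IsPartition n ps → ps ∈ partitions n
∈-partitions⁺ {n} {[]}     (isPartition _ pos refl) = complete n n [] [-] pos refl ≤-refl
∈-partitions⁺ {n} {p ∷ ps} (isPartition l pos refl) =
  complete n n (p ∷ ps) (m≤m+n p (sum ps) ∷ l) pos refl ≤-refl

partitions-unique : ∀ n → Unique (partitions n)
partitions-unique n = unique n n n

{-# OPTIONS --safe #-}
-- The 2-cores are exactly the staircases (k, k − 1, …, 1), and a staircase of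
-- size n satisfies 1 + 8n = (1 + 2k)².  So a 2 n is 1 or 0 according to whether
-- 1 + 8n is a square.  For n = (9^β − 1) / 8 it is the square of 3^β; for the
-- first family it is 9^(α − 1) · 3 · r with 3 ∤ r, whose 3-adic valuation is odd.
module Submission where

open import Defs
open import Data.Nat using (ℕ; _+_; _*_; _∸_; _^_; _≤_; _/_; _%_)
open import Data.Product using (_×_)
open import Data.Sum using (_⊎_)
open import Relation.Binary.PropositionalEquality using (_≡_)

open import Data.List using (List; []; _∷_; length; filter; map; upTo; downFrom)
open import Data.List.Membership.Propositional using (_∈_)
open import Data.List.Membership.Propositional.Properties
  using (∈-filter⁺; ∈-filter⁻; ∈-upTo⁺)
open import Data.List.Properties using (filter-accept; filter-reject)
open import Data.List.Relation.Unary.All as All using (All; []; _∷_)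
import Data.List.Relation.Unary.All.Properties as All
open import Data.List.Relation.Unary.Any using (here; there)
open import Data.List.Relation.Unary.Linked as Linked using (Linked; []; [-]; _∷_)
open import Data.List.Relation.Unary.Unique.Propositional using (Unique; []; _∷_)
import Data.List.Relation.Unary.Unique.Propositional.Properties as Unique
open import Data.Nat using (zero; suc; _≥_; _<_; _<?_; z<s; s≤s; s≤s⁻¹; s<s⁻¹)
open import Data.Nat.DivMod using (m*n/n≡m)
open import Data.Nat.Divisibility
  using (_∣_; _∤_; _∣?_; divides; ∣m+n∣m⇒∣n; m∣m*n; ∣n⇒∣m*n; ∣-refl)
open import Data.Nat.ListAction using (sum)
open import Data.Nat.Primality using (prime?; euclidsLemma)
open import Data.Nat.Properties
open import Data.Nat.Tactic.RingSolver using (solve-∀)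
open import Data.Product using (_,_; ∃)
open import Data.Sum using (inj₁; inj₂; reduce)
open import Relation.Binary.Definitions using (tri<; tri≈; tri>)
open import Relation.Binary.PropositionalEquality
  using (_≢_; refl; sym; trans; cong; cong₂; subst; module ≡-Reasoning)
open import Relation.Nullary using (yes; no; contradiction)
open import Relation.Nullary.Decidable using (from-yes; from-no)

m*m≡n*n⇒m≡n : ∀ {m n} → m * m ≡ n * n → m ≡ n
m*m≡n*n⇒m≡n {m} {n} eq with <-cmp m n
... | tri< m<n _ _ = contradiction eq (<⇒≢ (*-mono-< m<n m<n))
... | tri≈ _ m≡n _ = m≡n
... | tri> _ _ n<m = contradiction (sym eq) (<⇒≢ (*-mono-< n<m n<m))

length≡1 : ∀ {A : Set} {x : A} {xs} → Unique xs → x ∈ xs → (∀ {y} → y ∈ xs → y ≡ x) → length xs ≡ 1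
length≡1 {xs = _ ∷ []}    _ _ _ = refl
length≡1 {xs = _ ∷ _ ∷ _} ((y≢z ∷ _) ∷ _) _ all≡x =
  contradiction (trans (all≡x (here refl)) (sym (all≡x (there (here refl))))) y≢z

-- Staircases and triangular numbers

-- With this encoding `staircase (suc k)` computes to `suc k ∷ staircase k`, so removing the first
-- row leaves the next smaller staircase.
staircase : ℕ → List ℕ
staircase k = map suc (downFrom k)

staircase-linked : ∀ k → Linked _≥_ (staircase k)
staircase-linked 0             = []
staircase-linked 1             = [-]
staircase-linked (suc (suc k)) = n≤1+n _ ∷ staircase-linked (suc k)

staircase-positive : ∀ k → All (0 <_) (staircase k)
staircase-positive k = All.map⁺ (All.universal (λ _ → z<s) (downFrom k))

-- Adding the row of length k + 1 adds 8(k + 1), the gap between the consecutive odd squares (2k +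
-- 1)² and (2k + 3)².
1+8*sum-staircase : ∀ k → 1 + 8 * sum (staircase k) ≡ (1 + 2 * k) * (1 + 2 * k)
1+8*sum-staircase zero    = refl
1+8*sum-staircase (suc k) = begin
  1 + 8 * (suc k + sum (staircase k))          ≡⟨ regroup k (sum (staircase k)) ⟩
  8 * suc k + (1 + 8 * sum (staircase k))      ≡⟨ cong (8 * suc k +_) (1+8*sum-staircase k) ⟩
  8 * suc k + (1 + 2 * k) * (1 + 2 * k)        ≡⟨ square k ⟩
  (1 + 2 * suc k) * (1 + 2 * suc k)            ∎
  where
  open ≡-Reasoning
  regroup : ∀ k s → 1 + 8 * (suc k + s) ≡ 8 * suc k + (1 + 8 * s)
  regroup = solve-∀
  square : ∀ k → 8 * suc k + (1 + 2 * k) * (1 + 2 * k) ≡ (1 + 2 * suc k) * (1 + 2 * suc k)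
  square = solve-∀

sum-staircase-injective : ∀ {k l} → sum (staircase k) ≡ sum (staircase l) → k ≡ l
sum-staircase-injective {k} {l} eq = *-cancelˡ-≡ k l 2 (suc-injective (m*m≡n*n⇒m≡n (begin
  (1 + 2 * k) * (1 + 2 * k)  ≡⟨ 1+8*sum-staircase k ⟨
  1 + 8 * sum (staircase k)  ≡⟨ cong (λ s → 1 + 8 * s) eq ⟩
  1 + 8 * sum (staircase l)  ≡⟨ 1+8*sum-staircase l ⟩
  (1 + 2 * l) * (1 + 2 * l)  ∎)))
  where open ≡-Reasoning

-- Hook lengths and the classification of 2-cores

rows-longer-than : ∀ j k → length (filter (j <?_) (staircase k)) ≡ k ∸ j
rows-longer-than j zero = sym (0∸n≡0 j)
rows-longer-than j (suc k) with j <? suc k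
... | yes j<1+k = begin
  length (filter (j <?_) (staircase (suc k)))  ≡⟨ cong length (filter-accept (j <?_) j<1+k) ⟩
  suc (length (filter (j <?_) (staircase k)))  ≡⟨ cong suc (rows-longer-than j k) ⟩
  suc (k ∸ j)                                  ≡⟨ +-∸-assoc 1 (s≤s⁻¹ j<1+k) ⟨
  suc k ∸ j                                    ∎
  where open ≡-Reasoning
-- Here j exceeds every row, and both truncated differences are 0.
... | no j≮1+k = begin
  length (filter (j <?_) (staircase (suc k)))  ≡⟨ cong length (filter-reject (j <?_) j≮1+k) ⟩
  length (filter (j <?_) (staircase k))        ≡⟨ rows-longer-than j k ⟩
  k ∸ j                                        ≡⟨ m≤n⇒m∸n≡0 (≤-trans (n≤1+n k) (≮⇒≥ j≮1+k)) ⟩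
  0                                            ≡⟨ m≤n⇒m∸n≡0 (≮⇒≥ j≮1+k) ⟨
  suc k ∸ j                                    ∎
  where open ≡-Reasoning

hookLength-staircase : ∀ p k j → hookLength p (staircase k) j ≡ (p ∸ suc j) + (k ∸ j) + 1
hookLength-staircase p k j = cong (λ l → (p ∸ suc j) + l + 1) (rows-longer-than j k)

2∤m+m+1 : ∀ m → 2 ∤ m + m + 1
2∤m+m+1 m 2∣ = from-no (2 ∣? 1) (∣m+n∣m⇒∣n 2∣ (divides m (double m)))
  where
  double : ∀ m → m + m ≡ m * 2
  double = solve-∀

-- Each cell of the first row has arm and leg both equal to `k ∸ j`, so its hook length is odd; the
-- rows below form a smaller staircase.
staircase-core : ∀ k → IsCore 2 (staircase k)
staircase-core zero    = []
staircase-core (suc k) = All.++⁺ (All.map⁺ (All.universal odd (upTo (suc k)))) (staircase-core k)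
  where
  odd : ∀ j → 2 ∤ hookLength (suc k) (staircase k) j
  odd j = subst (2 ∤_) (sym (hookLength-staircase (suc k) k j)) (2∤m+m+1 (k ∸ j))

-- If p ≠ 1 + k then one of the last two cells of the first row has hook length 2.
first-row : ∀ p k → Linked _≥_ (p ∷ staircase k) → 0 < p →
            (∀ {j} → j < p → 2 ∤ hookLength p (staircase k) j) → p ≡ suc k
first-row p k linked 0<p core with <-cmp p (suc k)
... | tri≈ _ p≡1+k _ = p≡1+k
first-row p zero linked 0<p core | tri< p<1 _ _ = contradiction 0<p (<⇒≱ p<1)
-- Weak decrease leaves only p equal to the row below it. The last cell then has arm 0 and leg 1.
first-row p (suc k) (p≥1+k ∷ _) 0<p core | tri< p<2+k _ _
  with refl ← ≤-antisym (s≤s⁻¹ p<2+k) p≥1+k = contradiction 2∣hook (core ≤-refl)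
  where
  open ≡-Reasoning
  hook≡2 : hookLength (suc k) (staircase (suc k)) k ≡ 2
  hook≡2 = begin
    hookLength (suc k) (staircase (suc k)) k  ≡⟨ hookLength-staircase (suc k) (suc k) k ⟩
    (k ∸ k) + (suc k ∸ k) + 1                 ≡⟨ cong₂ (λ x y → x + y + 1) (n∸n≡0 k) (m+n∸n≡m 1 k) ⟩
    2                                         ∎
  2∣hook : 2 ∣ hookLength (suc k) (staircase (suc k)) k
  2∣hook = subst (2 ∣_) (sym hook≡2) ∣-refl
first-row (suc zero) k linked 0<p core | tri> _ _ (s≤s ())
-- Column q is the last but one. Its arm is 1, and its leg is 0 because k ≤ q.
first-row (suc (suc q)) k linked 0<p core | tri> _ _ 1+k<2+q =
  contradiction (subst (2 ∣_) (sym hook≡2) ∣-refl) (core (n≤1+n (suc q)))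
  where
  open ≡-Reasoning
  hook≡2 : hookLength (suc (suc q)) (staircase k) q ≡ 2
  hook≡2 = begin
    hookLength (suc (suc q)) (staircase k) q  ≡⟨ hookLength-staircase (suc (suc q)) k q ⟩
    (suc q ∸ q) + (k ∸ q) + 1                 ≡⟨ cong₂ (λ x y → x + y + 1) (m+n∸n≡m 1 q) (m≤n⇒m∸n≡0 (s≤s⁻¹ (s<s⁻¹ 1+k<2+q))) ⟩
    2                                         ∎

-- Induction from the bottom row up: the hooks below the first row are those of the tail, so the
-- tail is a staircase, and `first-row` then leaves one possible length for the row above it.
core⇒staircase : ∀ {ps} → Linked _≥_ ps → All (0 <_) ps → IsCore 2 ps → ps ≡ staircase (length ps)
core⇒staircase {[]}     _      _           _    = refl
core⇒staircase {p ∷ ps} linked (0<p ∷ pos) core = cong₂ _∷_ p≡ ps≡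
  where
  ps≡ : ps ≡ staircase (length ps)
  ps≡ = core⇒staircase (Linked.tail linked) pos (All.++⁻ʳ (map (hookLength p ps) (upTo p)) core)
  row-core : ∀ {j} → j < p → 2 ∤ hookLength p ps j
  row-core j<p = All.lookup (All.map⁻ (All.++⁻ˡ (map (hookLength p ps) (upTo p)) core)) (∈-upTo⁺ j<p)
  p≡ : p ≡ suc (length ps)
  p≡ = first-row p (length ps) (subst (λ qs → Linked _≥_ (p ∷ qs)) ps≡ linked) 0<p
         (λ {j} j<p → subst (λ qs → 2 ∤ hookLength p qs j) ps≡ (row-core j<p))

-- Counting 2-cores

2-core-of : ∀ {n ps} → ps ∈ filter (isCore? 2) (partitions n) →
            ∃ λ k → ps ≡ staircase k × sum (staircase k) ≡ n
2-core-of {n} {ps} ps∈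
  with ps∈′ , core ← ∈-filter⁻ (isCore? 2) {xs = partitions n} ps∈
  with isPartition linked pos sum≡n ← ∈-partitions⁻ ps∈′
  = length ps , ps≡ , trans (cong sum (sym ps≡)) sum≡n
  where
  ps≡ : ps ≡ staircase (length ps)
  ps≡ = core⇒staircase linked pos core

-- The filtered list has no repetitions and contains the staircase; any other entry would be a
-- staircase of the same size, hence of the same height.
a₂-triangular : ∀ k → a 2 (sum (staircase k)) ≡ 1
a₂-triangular k = length≡1
  (Unique.filter⁺ (isCore? 2) (partitions-unique (sum (staircase k))))
  (∈-filter⁺ (isCore? 2)
    (∈-partitions⁺ (isPartition (staircase-linked k) (staircase-positive k) refl))
    (staircase-core k))
  λ ps∈ → let _ , ps≡ , sum≡ = 2-core-of {sum (staircase k)} ps∈ in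
    trans ps≡ (cong staircase (sum-staircase-injective sum≡))

-- A first entry of the filtered list would be a staircase of some height k, making 1 + 8n the
-- square of 1 + 2k.
a₂-nontriangular : ∀ n → (∀ m → m * m ≢ 1 + 8 * n) → a 2 n ≡ 0
a₂-nontriangular n nonsquare with filter (isCore? 2) (partitions n) in eq
... | []     = refl
... | ps ∷ _ with k , _ , sum≡n ← 2-core-of {n} {ps} (subst (ps ∈_) (sym eq) (here refl)) =
  contradiction
    (trans (sym (1+8*sum-staircase k)) (cong (λ s → 1 + 8 * s) sum≡n))
    (nonsquare (1 + 2 * k))

-- Powers of 3 and 3-adic valuation

3^-odd : ∀ β → ∃ λ k → 3 ^ β ≡ 1 + 2 * k
3^-odd zero    = 0 , refl
3^-odd (suc β) with k , 3^β≡ ← 3^-odd β = 1 + 3 * k , trans (cong (3 *_) 3^β≡) (triple k)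
  where
  triple : ∀ k → 3 * (1 + 2 * k) ≡ 1 + 2 * (1 + 3 * k)
  triple = solve-∀

^-double : ∀ m n → m ^ (2 * n) ≡ m ^ n * m ^ n
^-double m n = trans (cong (m ^_) (cong (n +_) (+-identityʳ n))) (^-distribˡ-+-* m n n)

-- The root `3 ^ β` is odd, say 1 + 2k, and this k is the height of the staircase. The same equation
-- shows that the division by 8 in the theorem is exact.
9^-triangular : ∀ β → ∃ λ k → 3 ^ (2 * β) ≡ 1 + 8 * sum (staircase k)
9^-triangular β with k , 3^β≡ ← 3^-odd β =
  k , trans (^-double 3 β) (trans (cong₂ _*_ 3^β≡ 3^β≡) (sym (1+8*sum-staircase k)))

3^[2*[1+α]] : ∀ α → 3 ^ (2 * suc α) ≡ 9 * 3 ^ (2 * α)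
3^[2*[1+α]] α = trans (cong (3 ^_) (*-suc 2 α)) (sym (*-assoc 3 3 (3 ^ (2 * α))))

[1+8*m∸1]/8 : ∀ {x} m → x ≡ 1 + 8 * m → (x ∸ 1) / 8 ≡ m
[1+8*m∸1]/8 m refl = trans (cong (_/ 8) (*-comm 8 m)) (m*n/n≡m m 8)

3∣m*m⇒3∣m : ∀ m → 3 ∣ m * m → 3 ∣ m
3∣m*m⇒3∣m m 3∣m² = reduce (euclidsLemma m m (from-yes (prime? 3)) 3∣m²)

-- Descent on α: 3 divides m, so m = 3q, and cancelling 9 gives the same equation for q with α one
-- smaller. At α = 0, 9q² = 3r would force 3 to divide r.
odd-valuation-nonsquare : ∀ α {r} → 3 ∤ r → ∀ m → m * m ≢ 3 ^ (2 * α) * (3 * r)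
odd-valuation-nonsquare zero {r} 3∤r m eq
  with divides q refl ← 3∣m*m⇒3∣m m (subst (3 ∣_) (sym (trans eq (*-identityˡ (3 * r)))) (m∣m*n r))
  = 3∤r (divides (q * q) (sym (*-cancelˡ-≡ (q * q * 3) r 3 (begin
      3 * (q * q * 3)  ≡⟨ regroup q ⟩
      q * 3 * (q * 3)  ≡⟨ eq ⟩
      1 * (3 * r)      ≡⟨ *-identityˡ (3 * r) ⟩
      3 * r            ∎))))
  where
  open ≡-Reasoning
  regroup : ∀ q → 3 * (q * q * 3) ≡ q * 3 * (q * 3)
  regroup = solve-∀
odd-valuation-nonsquare (suc α) {r} 3∤r m eq
  with divides q refl ← 3∣m*m⇒3∣m m
    (subst (3 ∣_) (sym eq) (∣n⇒∣m*n (3 ^ (2 * suc α)) (m∣m*n r)))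
  = odd-valuation-nonsquare α 3∤r q (*-cancelˡ-≡ (q * q) (3 ^ (2 * α) * (3 * r)) 9 (begin
      9 * (q * q)                    ≡⟨ regroup q ⟩
      q * 3 * (q * 3)                ≡⟨ eq ⟩
      3 ^ (2 * suc α) * (3 * r)      ≡⟨ cong (_* (3 * r)) (3^[2*[1+α]] α) ⟩
      9 * 3 ^ (2 * α) * (3 * r)      ≡⟨ *-assoc 9 (3 ^ (2 * α)) (3 * r) ⟩
      9 * (3 ^ (2 * α) * (3 * r))    ∎))
  where
  open ≡-Reasoning
  regroup : ∀ q → 9 * (q * q) ≡ q * 3 * (q * 3)
  regroup = solve-∀

-- The index α is one less than in the theorem, so that α ≥ 1 is built in and the descent can start
-- at 0.
progression : ℕ → ℕ → ℕ → ℕ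
progression α n i = 3 ^ (2 * suc α) * n + 3 ^ (2 * suc α ∸ 1) * i + (3 ^ (2 * suc α) ∸ 1) / 8

1+8*progression : ∀ α n i → 1 + 8 * progression α n i ≡ 3 ^ (2 * α) * (3 * (3 * (8 * n + 1) + 8 * i))
1+8*progression α n i with k , 9^≡ ← 9^-triangular (suc α) = begin
  1 + 8 * progression α n i
    -- The two powers of 3 become 9D and 3D, and the quotient becomes T. Since 1 + 8T = 9D, every
    -- term then has the factor 3D.
    ≡⟨ cong (λ x → 1 + 8 * x) (cong₂ _+_
         (cong₂ (λ x y → x * n + y * i) (3^[2*[1+α]] α) (cong (λ e → 3 ^ (e ∸ 1)) (*-suc 2 α)))
         ([1+8*m∸1]/8 T 9^≡)) ⟩
  1 + 8 * (9 * D * n + 3 * D * i + T)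
    ≡⟨ regroup D n i T ⟩
  8 * (9 * D * n + 3 * D * i) + (1 + 8 * T)
    ≡⟨ cong (8 * (9 * D * n + 3 * D * i) +_) (trans (sym 9^≡) (3^[2*[1+α]] α)) ⟩
  8 * (9 * D * n + 3 * D * i) + 9 * D
    ≡⟨ factor D n i ⟩
  D * (3 * (3 * (8 * n + 1) + 8 * i)) ∎
  where
  open ≡-Reasoning
  D = 3 ^ (2 * α)
  T = sum (staircase k)
  regroup : ∀ d n i t → 1 + 8 * (9 * d * n + 3 * d * i + t) ≡ 8 * (9 * d * n + 3 * d * i) + (1 + 8 * t)
  regroup = solve-∀
  factor : ∀ d n i → 8 * (9 * d * n + 3 * d * i) + 9 * d ≡ d * (3 * (3 * (8 * n + 1) + 8 * i))
  factor = solve-∀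

3∤8*i : ∀ {i} → i ≡ 1 ⊎ i ≡ 2 → 3 ∤ 8 * i
3∤8*i (inj₁ refl) = from-no (3 ∣? 8)
3∤8*i (inj₂ refl) = from-no (3 ∣? 16)

a₂-progression : ∀ α n i → i ≡ 1 ⊎ i ≡ 2 → a 2 (progression α n i) ≡ 0
-- The cofactor is r = 3(8n + 1) + 8i; if 3 divided it, 3 would divide 8i.
a₂-progression α n i i≡1⊎i≡2 = a₂-nontriangular (progression α n i) λ m m²≡ →
  odd-valuation-nonsquare α (λ 3∣r → 3∤8*i i≡1⊎i≡2 (∣m+n∣m⇒∣n 3∣r (m∣m*n (8 * n + 1)))) m
    (trans m²≡ (1+8*progression α n i))

theorem4p5 : (∀ (α n i : ℕ) → 1 ≤ α → i ≡ 1 ⊎ i ≡ 2 →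
    a 2 (3 ^ (2 * α) * n + 3 ^ (2 * α ∸ 1) * i + (3 ^ (2 * α) ∸ 1) / 8) % 2 ≡ 0)
    × (∀ (β : ℕ) → a 2 ((3 ^ (2 * β) ∸ 1) / 8) % 2 ≡ 1)
theorem4p5 =
  (λ { (suc α) n i _ i≡1⊎i≡2 → cong (_% 2) (a₂-progression α n i i≡1⊎i≡2) }) ,
  (λ β → let k , 9^β≡ = 9^-triangular β in
    cong (_% 2) (trans (cong (a 2) ([1+8*m∸1]/8 (sum (staircase k)) 9^β≡)) (a₂-triangular k)))
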